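{- Let $m$, $n$, and $s$ be positive integers, and let $G=\mathbb{Z}_n$ be the cyclic group of order $n$. 1. If $n=2m+1$, then the set $\{1,2,\dots,m\}$ is a perfect $1$-spanning set in $G$. 2. If $n=2s+1$, then the set $\{1\}$ is a perfect $s$-spanning set in $G$. 3. If $n=2s^2+2s+1$, then the set $\{s,s+1\}$ is a perfect $s$-spanning set in $G$.
   Context: The numbers $a(m,s)$, for non-negative integers $m,s$, are defined recursively by $a(m,0)=a(0,s)=1$ and, for $m,s\ge 1$, $a(m,s)=a(m-1,s)+a(m,s-1)+a(m-1,s-1)$. Let $G$ be a finite abelian group written additively and $A=\{a_1,\dots,a_m\}$ a subset of $G$ of size $m$. $A$ is an $s$-spanning set in $G$ if every $g\in G$ can be written as $g=\lambda_1a_1+\cdots+\lambda_m a_m$ for some integers $\lambda_1,\dots,\lambda_m$ with $|\lambda_1|+\cdots+|\lambda_m|\le s$. An $s$-spanning set $A$ of size $m$ in $G$ is called a perfect $s$-spanning set in $G$ if $|G|=a(m,s)$. Integers are regarded as elements of $\mathbb{Z}_n$ via reduction modulo $n$. -}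

module Defs where

open import Algebra.Bundles using (AbelianGroup)
import Algebra.Definitions.RawMonoid as RawMonoidDefs
open import Data.Fin.Base using (Fin)
open import Data.Integer.Base using (ℤ; +_; -[1+_]; _+_; _-_; -_; 0ℤ; ∣_∣)
open import Data.Integer.Divisibility.Signed using (_∣_; ∣m⇒∣-m; ∣m∣n⇒∣m+n; divides)
import Data.Integer.Properties as ℤ
open import Data.Integer.Tactic.RingSolver using (solve-∀)
open import Data.Nat.Base as ℕ using (ℕ; zero; suc; _≤_)
open import Data.Product.Base using (∃; _×_; _,_)
open import Data.Vec.Functional using (Vector)
open import Function.Bundles using (Inverse)
open import Function.Definitions using (Injective)
open import Level using (Level; _⊔_; 0ℓ)
open import Relation.Binary.PropositionalEquality as ≡ using (_≡_; subst)

a : ℕ → ℕ → ℕ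
a _       zero    = 1
a zero    (suc _) = 1
a (suc m) (suc s) = a m (suc s) ℕ.+ a (suc m) s ℕ.+ a m s

weight : ∀ {m} → Vector ℤ m → ℕ
weight c = RawMonoidDefs.sum ℕ.+-0-rawMonoid (λ i → ∣ c i ∣)

module _ {c ℓ : Level} (G : AbelianGroup c ℓ) where

  open AbelianGroup G using (Carrier; _≈_; _⁻¹; rawMonoid; setoid)
  open RawMonoidDefs rawMonoid using (sum) renaming (_×_ to _×ₙ_)

  infixr 8 _·_

  _·_ : ℤ → Carrier → Carrier
  (+ k)    · x = k ×ₙ x
  -[1+ k ] · x = (suc k ×ₙ x) ⁻¹

  linearCombination : ∀ {m} → Vector ℤ m → Vector Carrier m → Carrier
  linearCombination λs A = sum (λ i → λs i · A i)

  HasOrder : ℕ → Set (c ⊔ ℓ)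
  HasOrder k = Inverse (≡.setoid (Fin k)) setoid

  -- A subset of size m is given by an enumeration of its elements;
  -- `distinct` ensures that it has exactly m elements with respect to _≈_.
  record IsSpanningSet (s : ℕ) {m : ℕ} (A : Vector Carrier m) : Set (c ⊔ ℓ) where
    field
      distinct : Injective _≡_ _≈_ A
      spans    : ∀ g → ∃ λ (λs : Vector ℤ m) →
                   weight λs ≤ s × g ≈ linearCombination λs A

  record IsPerfectSpanningSet (s : ℕ) {m : ℕ} (A : Vector Carrier m) : Set (c ⊔ ℓ) where
    field
      isSpanningSet : IsSpanningSet s A
      order         : HasOrder (a m s)

-- ℤ/nℤ as a setoid quotient of ℤ: the carrier is ℤ and equality is congruence
-- modulo n, so that reduction modulo n is the identity on carriers.
ℤmod : ℕ → AbelianGroup 0ℓ 0ℓ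
ℤmod n = record
  { Carrier = ℤ
  ; _≈_     = _≈_
  ; _∙_     = _+_
  ; ε       = 0ℤ
  ; _⁻¹     = -_
  ; isAbelianGroup = record
    { isGroup = record
      { isMonoid = record
        { isSemigroup = record
          { isMagma = record
            { isEquivalence = record
              { refl  = λ {x} → reflexive {x} ≡.refl
              ; sym   = λ {x} {y} p → subst (+ n ∣_) (neg-minus x y) (∣m⇒∣-m p)
              ; trans = λ {x} {y} {z} p q →
                          subst (+ n ∣_) (minus-trans x y z) (∣m∣n⇒∣m+n p q)
              }
            ; ∙-cong = λ {x} {y} {u} {v} p q →
                         subst (+ n ∣_) (plus-minus x y u v) (∣m∣n⇒∣m+n p q)
            }
          ; assoc = λ x y z → reflexive (ℤ.+-assoc x y z)
          }
        ; identity = (λ x → reflexive (ℤ.+-identityˡ x))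
                   , (λ x → reflexive (ℤ.+-identityʳ x))
        }
      ; inverse = (λ x → reflexive (ℤ.+-inverseˡ x))
                , (λ x → reflexive (ℤ.+-inverseʳ x))
      ; ⁻¹-cong = λ {x} {y} p → subst (+ n ∣_) (minus-neg x y) (∣m⇒∣-m p)
      }
    ; comm = λ x y → reflexive (ℤ.+-comm x y)
    }
  }
  where
  _≈_ : ℤ → ℤ → Set
  x ≈ y = + n ∣ x - y

  reflexive : ∀ {x y} → x ≡ y → x ≈ y
  reflexive {x} ≡.refl = divides 0ℤ (ℤ.+-inverseʳ x)

  neg-minus : ∀ x y → - (x - y) ≡ y - x
  neg-minus = solve-∀

  minus-trans : ∀ x y z → (x - y) + (y - z) ≡ x - z
  minus-trans = solve-∀

  plus-minus : ∀ x y u v → (x - y) + (u - v) ≡ (x + u) - (y + v)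
  plus-minus = solve-∀

  minus-neg : ∀ x y → - (x - y) ≡ - x - - y
  minus-neg = solve-∀

{-# OPTIONS --safe #-}
-- With n = 2r + 1, every residue class modulo n has a representative h with
-- |h| ≤ r, so it suffices to write each such h exactly (not just modulo n) as an
-- integer combination of the generators with weight at most s. Only the last
-- part, where r = s² + s, needs an idea: the integer point (x , y) of the diamond
-- |x| + |y| ≤ s is sent to x s + y (s + 1) = (x + y) s + y, and these values are
-- reached one after the other, starting at h = 0; negative h follow by symmetry.
-- From h one gets to h + 1 by moving to (x - 1 , y + 1), on the same diagonal
-- x + y, and if this leaves the diamond, by jumping to (x + s , y + 1 - s) at the
-- other end of the next diagonal. Only the vertex (0 , s), where h = s² + s,
-- admits neither move.
module Submission where

open import Defs
open import Algebra.Bundles using (AbelianGroup)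
import Algebra.Properties.Monoid.Sum as MonoidSum
open import Data.Fin.Base using (Fin; zero; suc; toℕ; fromℕ<)
import Data.Fin.Properties as Fin
open import Data.Integer.Base as ℤ using (ℤ; +_; -[1+_]; 0ℤ; ∣_∣)
import Data.Integer.DivMod as ℤ
open import Data.Integer.Divisibility.Signed using (divides; ∣⇒∣ᵤ)
import Data.Integer.Properties as ℤ
import Data.Integer.Tactic.RingSolver as ℤ-Solver
open import Data.Nat.Base
  using (ℕ; zero; suc; _+_; _*_; _∸_; _^_; _⊔_; _≤_; _<_; z≤n; s≤s; NonZero
        ; >-nonZero; >-nonZero⁻¹)
open import Data.Nat.Divisibility using (>⇒∤) renaming (_∣_ to _∣ℕ_)
import Data.Nat.Properties as ℕ
import Data.Nat.Tactic.RingSolver as ℕ-Solver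
open import Data.Product.Base using (∃; ∃₂; _×_; _,_)
open import Data.Sum.Base using (_⊎_; inj₁; inj₂)
open import Data.Vec.Functional using (Vector; []; _∷_; replicate; updateAt)
open import Function.Base using (const)
open import Function.Definitions using (Injective)
open import Relation.Binary.PropositionalEquality
  using (_≡_; refl; sym; trans; cong; cong₂; subst; module ≡-Reasoning)
open import Relation.Nullary.Decidable using (yes; no)
open import Relation.Nullary.Negation using (contradiction)

-- Closed forms of the numbers `a m s`

a-zeroˡ : ∀ s → a 0 s ≡ 1
a-zeroˡ zero    = refl
a-zeroˡ (suc _) = refl

a-oneʳ : ∀ m → a m 1 ≡ 2 * m + 1
a-oneʳ zero    = refl
a-oneʳ (suc m) = trans (cong (λ k → k + 1 + 1) (a-oneʳ m)) (lemma m)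
  where
  lemma : ∀ m → 2 * m + 1 + 1 + 1 ≡ 2 * suc m + 1
  lemma = ℕ-Solver.solve-∀

a-oneˡ : ∀ s → a 1 s ≡ 2 * s + 1
a-oneˡ zero    = refl
a-oneˡ (suc s) = trans (cong₂ (λ j k → 1 + j + k) (a-oneˡ s) (a-zeroˡ s)) (lemma s)
  where
  lemma : ∀ s → 1 + (2 * s + 1) + 1 ≡ 2 * suc s + 1
  lemma = ℕ-Solver.solve-∀

-- These are the centred square numbers, which count the integer points of the diamond of radius
-- `s`. The form `2 * r + 1` with `r = s * s + s` is the one that balanced residues require.
a-twoˡ : ∀ s → a 2 s ≡ 2 * (s * s + s) + 1
a-twoˡ zero    = refl
a-twoˡ (suc s) = begin
  a 1 (suc s) + a 2 s + a 1 s
    ≡⟨ cong₂ _+_ (cong₂ _+_ (a-oneˡ (suc s)) (a-twoˡ s)) (a-oneˡ s) ⟩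
  (2 * suc s + 1) + (2 * (s * s + s) + 1) + (2 * s + 1)
    ≡⟨ lemma s ⟩
  2 * (suc s * suc s + suc s) + 1 ∎
  where
  open ≡-Reasoning
  lemma : ∀ s → (2 * suc s + 1) + (2 * (s * s + s) + 1) + (2 * s + 1) ≡
                2 * (suc s * suc s + suc s) + 1
  lemma = ℕ-Solver.solve-∀

-- Linear combinations with a single coefficient

single : ∀ {m} → Fin m → ℤ → Vector ℤ m
single {m} k c = updateAt (replicate m 0ℤ) k (const c)

weight-single : ∀ {m} (k : Fin m) c → weight (single k c) ≡ ∣ c ∣
weight-single {suc m} zero c =
  trans (cong (_+_ ∣ c ∣) (MonoidSum.sum-replicate-zero ℕ.+-0-monoid m))
        (ℕ.+-identityʳ ∣ c ∣)
weight-single (suc k) c = weight-single k c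

module _ {c ℓ} (G : AbelianGroup c ℓ) where

  open AbelianGroup G using (Carrier; _≈_; monoid; setoid; ∙-congˡ; identityˡ; identityʳ)
    renaming (trans to ≈-trans)

  linearCombination-single : ∀ {m} (k : Fin m) z (A : Vector Carrier m) →
    linearCombination G (single k z) A ≈ _·_ G z (A k)
  linearCombination-single {suc m} zero z A =
    -- A coefficient `0ℤ` makes its term reduce to the neutral element, so the remaining sum is
    -- definitionally one of constants.
    ≈-trans (∙-congˡ (MonoidSum.sum-replicate-zero monoid m)) (identityʳ _)
  linearCombination-single (suc k) z A =
    ≈-trans (identityˡ _) (linearCombination-single k z (λ i → A (suc i)))

-- Remainders and the order of the cyclic group

module _ (n : ℕ) where

  open AbelianGroup (ℤmod n) using (_≈_; reflexive) renaming (sym to ≈-sym; trans to ≈-trans)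

  ·≡* : ∀ z x → _·_ (ℤmod n) z x ≡ z ℤ.* x
  ·≡* (+ k)    x = nonNeg k
    where
    nonNeg : ∀ k → _·_ (ℤmod n) (+ k) x ≡ + k ℤ.* x
    nonNeg zero    = refl
    nonNeg (suc k) = trans (cong (ℤ._+_ x) (nonNeg k)) (sym (ℤ.suc-* (+ k) x))
  ·≡* -[1+ k ] x =
    trans (cong ℤ.-_ (·≡* (+ suc k) x)) (ℤ.neg-distribˡ-* (+ suc k) x)

  -- The difference is a multiple of `n` of absolute value at most `j ⊔ k`, hence below `n`, so it
  -- vanishes.
  residue-injective : ∀ {j k} → j < n → k < n → + j ≈ + k → j ≡ k
  residue-injective {j} {k} j<n k<n j≈k with ∣ + j ℤ.- + k ∣ in eq
  ... | zero  = ℤ.+-injective (ℤ.i-j≡0⇒i≡j (+ j) (+ k) (ℤ.∣i∣≡0⇒i≡0 eq))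
  ... | suc d = contradiction (subst (n ∣ℕ_) eq (∣⇒∣ᵤ j≈k)) (>⇒∤ d<n)
    where
    d<n : suc d < n
    d<n = begin-strict
      suc d            ≡⟨ eq ⟨
      ∣ + j ℤ.- + k ∣  ≡⟨ cong ∣_∣ (ℤ.m-n≡m⊖n j k) ⟩
      ∣ j ℤ.⊖ k ∣      ≤⟨ ℤ.∣m⊝n∣≤m⊔n j k ⟩
      j ⊔ k            <⟨ ℕ.⊔-lub j<n k<n ⟩
      n                ∎
      where open ℕ.≤-Reasoning

  module _ .{{_ : NonZero n}} where

    ≈-%ℕ : ∀ z → z ≈ + (z ℤ.%ℕ n)
    ≈-%ℕ z = divides (z ℤ./ℕ n) (begin
      z ℤ.- r                         ≡⟨ cong (ℤ._- r) (ℤ.a≡a%ℕn+[a/ℕn]*n z n) ⟩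
      r ℤ.+ (z ℤ./ℕ n) ℤ.* + n ℤ.- r  ≡⟨ lemma r _ ⟩
      (z ℤ./ℕ n) ℤ.* + n              ∎)
      where
      open ≡-Reasoning
      r : ℤ
      r = + (z ℤ.%ℕ n)
      lemma : ∀ i j → i ℤ.+ j ℤ.- i ≡ j
      lemma = ℤ-Solver.solve-∀

    ℤmod-hasOrder : HasOrder (ℤmod n) n
    ℤmod-hasOrder = record
      { to        = λ i → + toℕ i
      ; from      = from
      ; to-cong   = λ { {i} refl → reflexive {+ toℕ i} refl }
      ; from-cong = λ {x} {y} → from-cong {x} {y}
      ; inverse   = (λ { {x} refl → to-from x })
                  , (λ {i} {z} z≈i → trans (from-cong {z} {+ toℕ i} z≈i) (from-to i))
      }
      where
      from : ℤ → Fin n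
      from z = fromℕ< (ℤ.n%ℕd<d z n)

      to-from : ∀ z → + toℕ (from z) ≈ z
      to-from z = subst (λ k → + k ≈ z) (sym (Fin.toℕ-fromℕ< (ℤ.n%ℕd<d z n)))
                        (≈-sym {z} {+ (z ℤ.%ℕ n)} (≈-%ℕ z))

      -- With this, `from-cong` and `from-to` both follow from `to-from` without any computation of
      -- remainders.
      to-injective : ∀ {i j : Fin n} → + toℕ i ≈ + toℕ j → i ≡ j
      to-injective {i} {j} p =
        Fin.toℕ-injective (residue-injective (Fin.toℕ<n i) (Fin.toℕ<n j) p)

      from-cong : ∀ {x y} → x ≈ y → from x ≡ from y
      from-cong {x} {y} x≈y = to-injective
        (≈-trans {+ toℕ (from x)} {x} {+ toℕ (from y)} (to-from x)
          (≈-trans {x} {y} {+ toℕ (from y)} x≈y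
            (≈-sym {+ toℕ (from y)} {y} (to-from y))))

      from-to : ∀ i → from (+ toℕ i) ≡ i
      from-to i = to-injective (to-from (+ toℕ i))

-- Balanced residues modulo an odd number

module _ (r : ℕ) where

  private
    n : ℕ
    n = 2 * r + 1

    instance
      n≢0 : NonZero n
      n≢0 = >-nonZero (ℕ.m≤n+m 1 (2 * r))

  open AbelianGroup (ℤmod n) using (_≈_) renaming (trans to ≈-trans)

  -- A remainder `k` above `r` is replaced by `k - n`, and `n - k` is at most `n - (r + 1) = r`
  -- because `n` is `2 * r + 1`.
  balanced-residue : ∀ z → ∃ λ h → ∣ h ∣ ≤ r × z ≈ h
  balanced-residue z with z ℤ.%ℕ n ℕ.≤? r
  ... | yes k≤r = + (z ℤ.%ℕ n) , k≤r , ≈-%ℕ n z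
  ... | no  k≰r = + k ℤ.- + n , bound ,
      ≈-trans {z} {+ k} {+ k ℤ.- + n} (≈-%ℕ n z) (divides (+ 1) (lemma (+ k) (+ n)))
    where
    k : ℕ
    k = z ℤ.%ℕ n

    lemma : ∀ i j → i ℤ.- (i ℤ.- j) ≡ + 1 ℤ.* j
    lemma = ℤ-Solver.solve-∀

    n≡r+1+r : ∀ r → 2 * r + 1 ≡ r + suc r
    n≡r+1+r = ℕ-Solver.solve-∀

    bound : ∣ + k ℤ.- + n ∣ ≤ r
    bound = begin
      ∣ + k ℤ.- + n ∣    ≡⟨ cong ∣_∣ (ℤ.m-n≡m⊖n k n) ⟩
      ∣ k ℤ.⊖ n ∣        ≡⟨ ℤ.∣⊖∣-≤ (ℕ.<⇒≤ (ℤ.n%ℕd<d z n)) ⟩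
      n ∸ k              ≤⟨ ℕ.∸-monoʳ-≤ n (ℕ.≰⇒> k≰r) ⟩
      n ∸ suc r          ≡⟨ cong (_∸ suc r) (n≡r+1+r r) ⟩
      r + suc r ∸ suc r  ≡⟨ ℕ.m+n∸n≡m r (suc r) ⟩
      r                  ∎
      where open ℕ.≤-Reasoning

  isPerfectSpanningSet : ∀ {m s} {A : Vector ℤ m} →
    a m s ≡ n →
    Injective _≡_ _≈_ A →
    (∀ h → ∣ h ∣ ≤ r → ∃ λ (λs : Vector ℤ m) →
      weight λs ≤ s × h ≈ linearCombination (ℤmod n) λs A) →
    IsPerfectSpanningSet (ℤmod n) s A
  isPerfectSpanningSet {A = A} a≡n distinct spans = record
    { isSpanningSet = record
      { distinct = distinct
      ; spans    = λ g →
          let h  , ∣h∣≤r , g≈h = balanced-residue g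
              λs , w≤s   , h≈Σ = spans h ∣h∣≤r
          in  λs , w≤s , ≈-trans {g} {h} {linearCombination (ℤmod n) λs A} g≈h h≈Σ
      }
    ; order = subst (HasOrder (ℤmod n)) (sym a≡n) (ℤmod-hasOrder n)
    }

-- The generators 1, ..., m with s = 1

initialSegment-perfect : ∀ m →
  IsPerfectSpanningSet (ℤmod (2 * m + 1)) 1 (λ (i : Fin m) → + suc (toℕ i))
initialSegment-perfect m = isPerfectSpanningSet m (a-oneʳ m) distinct spans
  where
  n : ℕ
  n = 2 * m + 1

  A : Vector ℤ m
  A i = + suc (toℕ i)

  open AbelianGroup (ℤmod n) using (_≈_; reflexive) renaming (sym to ≈-sym; trans to ≈-trans)

  A<n : ∀ (i : Fin m) → suc (toℕ i) < n
  A<n i = begin-strict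
    suc (toℕ i)  ≤⟨ Fin.toℕ<n i ⟩
    m            ≤⟨ ℕ.m≤m+n m (m + 0) ⟩
    2 * m        <⟨ ℕ.m<m+n (2 * m) (s≤s z≤n) ⟩
    n            ∎
    where open ℕ.≤-Reasoning

  distinct : Injective _≡_ _≈_ A
  distinct {i} {j} p =
    Fin.toℕ-injective (ℕ.suc-injective (residue-injective n (A<n i) (A<n j) p))

  -- The generator at index `k` is `suc k`. Leaving the sign `c` open lets positive and negative `h`
  -- share one argument.
  spans-single : ∀ {k} (k<m : k < m) c → ∣ c ∣ ≡ 1 → ∃ λ (λs : Vector ℤ m) →
    weight λs ≤ 1 × c ℤ.* + suc k ≈ linearCombination (ℤmod n) λs A
  spans-single {k} k<m c ∣c∣≡1 =
      single i c
    , ℕ.≤-reflexive (trans (weight-single i c) ∣c∣≡1)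
    , ≈-sym {linearCombination (ℤmod n) (single i c) A} {c ℤ.* + suc k}
        (≈-trans {linearCombination (ℤmod n) (single i c) A} {_·_ (ℤmod n) c (A i)}
                 {c ℤ.* + suc k}
          (linearCombination-single (ℤmod n) i c A)
          (reflexive (trans (·≡* n c (A i))
            (cong (λ j → c ℤ.* + suc j) (Fin.toℕ-fromℕ< k<m)))))
    where
    i : Fin m
    i = fromℕ< k<m

  spans : ∀ h → ∣ h ∣ ≤ m → ∃ λ (λs : Vector ℤ m) →
    weight λs ≤ 1 × h ≈ linearCombination (ℤmod n) λs A
  spans (+ zero) _ =
      replicate m 0ℤ
    , ℕ.≤-trans (ℕ.≤-reflexive (MonoidSum.sum-replicate-zero ℕ.+-0-monoid m)) z≤n
    , reflexive (sym (MonoidSum.sum-replicate-zero ℤ.+-0-monoid m))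
  spans (+ suc k) k<m =
    subst (λ h → ∃ λ λs → weight λs ≤ 1 × h ≈ linearCombination (ℤmod n) λs A)
          (ℤ.*-identityˡ (+ suc k)) (spans-single k<m (+ 1) refl)
  spans -[1+ k ] k<m =
    subst (λ h → ∃ λ λs → weight λs ≤ 1 × h ≈ linearCombination (ℤmod n) λs A)
          (ℤ.-1*i≡-i (+ suc k)) (spans-single k<m -[1+ 0 ] refl)

-- The single generator 1

one-perfect : ∀ s → IsPerfectSpanningSet (ℤmod (2 * s + 1)) s (+ 1 ∷ [])
one-perfect s = isPerfectSpanningSet s (a-oneˡ s)
  (λ { {zero} {zero} _ → refl })
  (λ h ∣h∣≤s → h ∷ []
    , subst (_≤ s) (sym (ℕ.+-identityʳ ∣ h ∣)) ∣h∣≤s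
    , AbelianGroup.reflexive (ℤmod (2 * s + 1)) (sym
        (trans (ℤ.+-identityʳ _) (trans (·≡* (2 * s + 1) h (+ 1)) (ℤ.*-identityʳ h)))))

-- Walking through the integer points of the diamond

record InDiamond (S x y : ℤ) : Set where
  constructor inDiamond
  field
    -- One linear inequality for each side replaces the absolute values. In the form `0ℤ ≤ _` they
    -- can be added and carried along ring identities.
    x+y≥-S : 0ℤ ℤ.≤ S ℤ.+ x ℤ.+ y
    x+y≤S  : 0ℤ ℤ.≤ S ℤ.- x ℤ.- y
    x-y≥-S : 0ℤ ℤ.≤ S ℤ.+ x ℤ.- y
    x-y≤S  : 0ℤ ℤ.≤ S ℤ.- x ℤ.+ y

∣∣+∣∣-bound : ∀ {s i j} x y → + ∣ x ∣ ≡ i → + ∣ y ∣ ≡ j →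
  0ℤ ℤ.≤ + s ℤ.- (i ℤ.+ j) → ∣ x ∣ + ∣ y ∣ ≤ s
∣∣+∣∣-bound x y refl refl 0≤ = ℤ.drop‿+≤+ (ℤ.0≤i-j⇒j≤i 0≤)

-- For each choice of signs of `x` and `y`, exactly one side of the diamond is the bound sought.
∣x∣+∣y∣≤s : ∀ {s x y} → InDiamond (+ s) x y → ∣ x ∣ + ∣ y ∣ ≤ s
∣x∣+∣y∣≤s {s} {x} {y} (inDiamond p q u v)
  with ℤ.+∣i∣≡i⊎+∣i∣≡-i x | ℤ.+∣i∣≡i⊎+∣i∣≡-i y
... | inj₁ ∣x∣≡x  | inj₁ ∣y∣≡y =
      ∣∣+∣∣-bound x y ∣x∣≡x ∣y∣≡y (subst (0ℤ ℤ.≤_) (lemma (+ s) x y) q)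
  where
  lemma : ∀ S x y → S ℤ.- x ℤ.- y ≡ S ℤ.- (x ℤ.+ y)
  lemma = ℤ-Solver.solve-∀
... | inj₁ ∣x∣≡x  | inj₂ ∣y∣≡-y =
      ∣∣+∣∣-bound x y ∣x∣≡x ∣y∣≡-y (subst (0ℤ ℤ.≤_) (lemma (+ s) x y) v)
  where
  lemma : ∀ S x y → S ℤ.- x ℤ.+ y ≡ S ℤ.- (x ℤ.+ ℤ.- y)
  lemma = ℤ-Solver.solve-∀
... | inj₂ ∣x∣≡-x | inj₁ ∣y∣≡y =
      ∣∣+∣∣-bound x y ∣x∣≡-x ∣y∣≡y (subst (0ℤ ℤ.≤_) (lemma (+ s) x y) u)
  where
  lemma : ∀ S x y → S ℤ.+ x ℤ.- y ≡ S ℤ.- (ℤ.- x ℤ.+ y)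
  lemma = ℤ-Solver.solve-∀
... | inj₂ ∣x∣≡-x | inj₂ ∣y∣≡-y =
      ∣∣+∣∣-bound x y ∣x∣≡-x ∣y∣≡-y (subst (0ℤ ℤ.≤_) (lemma (+ s) x y) p)
  where
  lemma : ∀ S x y → S ℤ.+ x ℤ.+ y ≡ S ℤ.- (ℤ.- x ℤ.+ ℤ.- y)
  lemma = ℤ-Solver.solve-∀

-- Over the integers `i < 0` means `- i - 1 ≥ 0`, so both alternatives are again of the form
-- `0ℤ ≤ _`.
nonNeg⊎neg : ∀ i → 0ℤ ℤ.≤ i ⊎ 0ℤ ℤ.≤ ℤ.- i ℤ.- + 1
nonNeg⊎neg (+ n)    = inj₁ (ℤ.+≤+ z≤n)
nonNeg⊎neg -[1+ n ] = inj₂ (ℤ.+≤+ z≤n)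

Reached : ℤ → ℤ → Set
Reached S h = ∃₂ λ x y → InDiamond S x y × h ≡ x ℤ.* S ℤ.+ y ℤ.* (S ℤ.+ + 1)

reach-suc : ∀ {S h} → + 1 ℤ.≤ S → h ℤ.< S ℤ.* S ℤ.+ S → Reached S h → Reached S (+ 1 ℤ.+ h)
reach-suc {S} {h} 1≤S h<S²+S (x , y , inDiamond p q u v , refl)
  -- The move along the diagonal keeps `x + y` and lowers `x - y` by 2, so only the bound `x-y≥-S`
  -- can fail.
  with nonNeg⊎neg (S ℤ.+ x ℤ.- y ℤ.- + 2)
... | inj₁ room =
      x ℤ.- + 1 , y ℤ.+ + 1
    , inDiamond
        (subst (0ℤ ℤ.≤_) (p′ S x y) p)
        (subst (0ℤ ℤ.≤_) (q′ S x y) q)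
        (subst (0ℤ ℤ.≤_) (u′ S x y) room)
        (subst (0ℤ ℤ.≤_) (v′ S x y) (ℤ.+-mono-≤ v (ℤ.+≤+ (z≤n {2}))))
    , value S x y
  where
  p′ : ∀ S x y → S ℤ.+ x ℤ.+ y ≡ S ℤ.+ (x ℤ.- + 1) ℤ.+ (y ℤ.+ + 1)
  p′ = ℤ-Solver.solve-∀
  q′ : ∀ S x y → S ℤ.- x ℤ.- y ≡ S ℤ.- (x ℤ.- + 1) ℤ.- (y ℤ.+ + 1)
  q′ = ℤ-Solver.solve-∀
  u′ : ∀ S x y → S ℤ.+ x ℤ.- y ℤ.- + 2 ≡ S ℤ.+ (x ℤ.- + 1) ℤ.- (y ℤ.+ + 1)
  u′ = ℤ-Solver.solve-∀
  v′ : ∀ S x y → (S ℤ.- x ℤ.+ y) ℤ.+ + 2 ≡ S ℤ.- (x ℤ.- + 1) ℤ.+ (y ℤ.+ + 1)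
  v′ = ℤ-Solver.solve-∀
  value : ∀ S x y → + 1 ℤ.+ (x ℤ.* S ℤ.+ y ℤ.* (S ℤ.+ + 1)) ≡
                    (x ℤ.- + 1) ℤ.* S ℤ.+ (y ℤ.+ + 1) ℤ.* (S ℤ.+ + 1)
  value = ℤ-Solver.solve-∀
-- The jump raises `x + y` by 1, which is what this test allows, and the value by
-- `S * S + (1 - S) * (S + 1) = 1`. It raises `x - y` by `2 * S - 1`; `tight` is exactly the upper
-- bound needed afterwards, and `1 ≤ S` preserves the lower one.
... | inj₂ tight with nonNeg⊎neg (S ℤ.- x ℤ.- y ℤ.- + 1)
...   | inj₁ room =
      x ℤ.+ S , y ℤ.+ + 1 ℤ.- S
    , inDiamond
        (subst (0ℤ ℤ.≤_) (p′ S x y) (ℤ.+-mono-≤ p (ℤ.+≤+ (z≤n {1}))))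
        (subst (0ℤ ℤ.≤_) (q′ S x y) room)
        (subst (0ℤ ℤ.≤_) (u′ S x y)
          (ℤ.+-mono-≤ u (ℤ.+-mono-≤ 0≤S-1 (ℤ.+-mono-≤ 0≤S-1 (ℤ.+≤+ (z≤n {1}))))))
        (subst (0ℤ ℤ.≤_) (v′ S x y) tight)
    , value S x y
  where
  0≤S-1 : 0ℤ ℤ.≤ S ℤ.- + 1
  0≤S-1 = ℤ.i≤j⇒0≤j-i 1≤S
  p′ : ∀ S x y → (S ℤ.+ x ℤ.+ y) ℤ.+ + 1 ≡ S ℤ.+ (x ℤ.+ S) ℤ.+ (y ℤ.+ + 1 ℤ.- S)
  p′ = ℤ-Solver.solve-∀
  q′ : ∀ S x y → S ℤ.- x ℤ.- y ℤ.- + 1 ≡ S ℤ.- (x ℤ.+ S) ℤ.- (y ℤ.+ + 1 ℤ.- S)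
  q′ = ℤ-Solver.solve-∀
  u′ : ∀ S x y → (S ℤ.+ x ℤ.- y) ℤ.+ ((S ℤ.- + 1) ℤ.+ ((S ℤ.- + 1) ℤ.+ + 1)) ≡
                 S ℤ.+ (x ℤ.+ S) ℤ.- (y ℤ.+ + 1 ℤ.- S)
  u′ = ℤ-Solver.solve-∀
  v′ : ∀ S x y → ℤ.- (S ℤ.+ x ℤ.- y ℤ.- + 2) ℤ.- + 1 ≡
                 S ℤ.- (x ℤ.+ S) ℤ.+ (y ℤ.+ + 1 ℤ.- S)
  v′ = ℤ-Solver.solve-∀
  value : ∀ S x y → + 1 ℤ.+ (x ℤ.* S ℤ.+ y ℤ.* (S ℤ.+ + 1)) ≡
                    (x ℤ.+ S) ℤ.* S ℤ.+ (y ℤ.+ + 1 ℤ.- S) ℤ.* (S ℤ.+ + 1)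
  value = ℤ-Solver.solve-∀
-- Here `full` puts the point on the side `x + y = S`, where `tight` reads `2 * x ≤ 1`, while the
-- bound on `h` gives `x ≥ 1`.
...   | inj₂ full = contradiction 0≤-1 λ ()
  where
  y≡S-x : y ≡ S ℤ.- x
  y≡S-x = ℤ.≤-antisym
    (ℤ.0≤i-j⇒j≤i q)
    (ℤ.0≤i-j⇒j≤i (subst (0ℤ ℤ.≤_) (lemma S x y) full))
    where
    lemma : ∀ S x y → ℤ.- (S ℤ.- x ℤ.- y ℤ.- + 1) ℤ.- + 1 ≡ y ℤ.- (S ℤ.- x)
    lemma = ℤ-Solver.solve-∀

  0≤1-2x : 0ℤ ℤ.≤ + 1 ℤ.- x ℤ.- x
  0≤1-2x = subst (0ℤ ℤ.≤_)
    (trans (cong (λ y → ℤ.- (S ℤ.+ x ℤ.- y ℤ.- + 2) ℤ.- + 1) y≡S-x) (lemma S x)) tight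
    where
    lemma : ∀ S x → ℤ.- (S ℤ.+ x ℤ.- (S ℤ.- x) ℤ.- + 2) ℤ.- + 1 ≡ + 1 ℤ.- x ℤ.- x
    lemma = ℤ-Solver.solve-∀

  -- On the side `y = S - x` the value is `S * S + S - x`, so lying strictly below `S * S + S`
  -- forces `x ≥ 1`.
  0≤x-1 : 0ℤ ℤ.≤ x ℤ.- + 1
  0≤x-1 = subst (0ℤ ℤ.≤_)
    (trans (cong (λ y → S ℤ.* S ℤ.+ S ℤ.- (+ 1 ℤ.+ (x ℤ.* S ℤ.+ y ℤ.* (S ℤ.+ + 1)))) y≡S-x)
           (lemma S x))
    (ℤ.i≤j⇒0≤j-i (ℤ.i<j⇒suc[i]≤j h<S²+S))
    where
    lemma : ∀ S x → S ℤ.* S ℤ.+ S ℤ.- (+ 1 ℤ.+ (x ℤ.* S ℤ.+ (S ℤ.- x) ℤ.* (S ℤ.+ + 1))) ≡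
                    x ℤ.- + 1
    lemma = ℤ-Solver.solve-∀

  0≤-1 : 0ℤ ℤ.≤ -[1+ 0 ]
  0≤-1 = subst (0ℤ ℤ.≤_) (lemma x) (ℤ.+-mono-≤ 0≤x-1 (ℤ.+-mono-≤ 0≤x-1 0≤1-2x))
    where
    lemma : ∀ x → (x ℤ.- + 1) ℤ.+ ((x ℤ.- + 1) ℤ.+ (+ 1 ℤ.- x ℤ.- x)) ≡ -[1+ 0 ]
    lemma = ℤ-Solver.solve-∀

reach : ∀ s .{{_ : NonZero s}} h → h ≤ s * s + s → Reached (+ s) (+ h)
reach s zero    _ = 0ℤ , 0ℤ , inDiamond 0≤S+0 0≤S+0 0≤S+0 0≤S+0 , refl
  where
  0≤S+0 : 0ℤ ℤ.≤ + s ℤ.+ 0ℤ ℤ.+ 0ℤ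
  0≤S+0 = ℤ.+≤+ z≤n
reach s (suc h) h<s²+s = reach-suc (ℤ.+≤+ (>-nonZero⁻¹ s))
  (subst (λ k → + h ℤ.< k ℤ.+ + s) (ℤ.pos-* s s) (ℤ.+<+ h<s²+s))
  (reach s h (ℕ.<⇒≤ h<s²+s))

consecutive-span : ∀ s .{{_ : NonZero s}} h → ∣ h ∣ ≤ s * s + s → ∃₂ λ x y →
  ∣ x ∣ + ∣ y ∣ ≤ s × h ≡ x ℤ.* + s ℤ.+ y ℤ.* + (s + 1)
consecutive-span s (+ h) h≤ =
  let x , y , xy∈ , h≡ = reach s h h≤
  -- `+ s + + 1` computes to `+ (s + 1)`, so `h≡` fits as it is.
  in  x , y , ∣x∣+∣y∣≤s xy∈ , h≡
consecutive-span s -[1+ h ] h≤ =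
  let x , y , xy∈ , h≡ = reach s (suc h) h≤
  in  ℤ.- x , ℤ.- y
    , subst (_≤ s) (sym (cong₂ _+_ (ℤ.∣-i∣≡∣i∣ x) (ℤ.∣-i∣≡∣i∣ y))) (∣x∣+∣y∣≤s xy∈)
    , trans (cong ℤ.-_ h≡) (lemma x (+ s) y (+ (s + 1)))
  where
  lemma : ∀ i j k l → ℤ.- (i ℤ.* j ℤ.+ k ℤ.* l) ≡ ℤ.- i ℤ.* j ℤ.+ ℤ.- k ℤ.* l
  lemma = ℤ-Solver.solve-∀

-- The generators s and s + 1

consecutive-perfect : ∀ s .{{_ : NonZero s}} →
  IsPerfectSpanningSet (ℤmod (2 * (s * s + s) + 1)) s (+ s ∷ + (s + 1) ∷ [])
consecutive-perfect s = isPerfectSpanningSet (s * s + s) (a-twoˡ s) distinct spans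
  where
  n : ℕ
  n = 2 * (s * s + s) + 1

  A : Vector ℤ 2
  A = + s ∷ + (s + 1) ∷ []

  open AbelianGroup (ℤmod n) using (_≈_; reflexive)

  s<s+1 : s < s + 1
  s<s+1 = ℕ.m<m+n s (s≤s z≤n)

  -- Both generators lie below `n`, so `residue-injective` tells them apart. Positivity of `s` makes
  -- `r` positive, whence `s ≤ r < 2 * r`.
  s+1<n : s + 1 < n
  s+1<n = ℕ.+-monoˡ-< 1 (begin-strict
    s                ≤⟨ ℕ.m≤n+m s (s * s) ⟩
    r                <⟨ ℕ.m<m+n r (ℕ.<-≤-trans (>-nonZero⁻¹ s) (ℕ.m≤n+m s (s * s))) ⟩
    r + r            ≡⟨ cong (_+_ r) (ℕ.+-identityʳ r) ⟨
    2 * r            ∎)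
    where
    open ℕ.≤-Reasoning
    r : ℕ
    r = s * s + s

  s<n : s < n
  s<n = ℕ.<-trans s<s+1 s+1<n

  distinct : Injective _≡_ _≈_ A
  distinct {zero}     {zero}     _ = refl
  distinct {zero}     {suc zero} p = contradiction (residue-injective n s<n s+1<n p) (ℕ.<⇒≢ s<s+1)
  distinct {suc zero} {zero}     p = contradiction (residue-injective n s+1<n s<n p) (ℕ.>⇒≢ s<s+1)
  distinct {suc zero} {suc zero} _ = refl

  spans : ∀ h → ∣ h ∣ ≤ s * s + s → ∃ λ (λs : Vector ℤ 2) →
    weight λs ≤ s × h ≈ linearCombination (ℤmod n) λs A
  spans h h≤ =
    let x , y , w≤s , h≡ = consecutive-span s h h≤
    in  (x ∷ y ∷ [])
      , subst (λ k → ∣ x ∣ + k ≤ s) (sym (ℕ.+-identityʳ ∣ y ∣)) w≤s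
      , reflexive (trans h≡ (sym (cong₂ ℤ._+_ (·≡* n x (+ s))
          (trans (ℤ.+-identityʳ _) (·≡* n y (+ (s + 1)))))))

proposition5 : (m n s : ℕ) .{{_ : NonZero m}} .{{_ : NonZero n}} .{{_ : NonZero s}} →
    (n ≡ 2 * m + 1 → IsPerfectSpanningSet (ℤmod n) 1 (λ (i : Fin m) → + suc (toℕ i))) ×
    (n ≡ 2 * s + 1 → IsPerfectSpanningSet (ℤmod n) s (+ 1 ∷ [])) ×
    (n ≡ 2 * s ^ 2 + 2 * s + 1 → IsPerfectSpanningSet (ℤmod n) s (+ s ∷ + (s + 1) ∷ []))
proposition5 m n s =
    (λ { refl → initialSegment-perfect m })
  , (λ { refl → one-perfect s })
  , (λ n≡ → subst (λ n → IsPerfectSpanningSet (ℤmod n) s (+ s ∷ + (s + 1) ∷ []))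
                  (sym (trans n≡ (factor s))) (consecutive-perfect s))
  where
  -- The left side is `2 * s ^ 2 + 2 * s + 1` with the power unfolded.
  factor : ∀ s → 2 * (s * (s * 1)) + 2 * s + 1 ≡ 2 * (s * s + s) + 1
  factor = ℕ-Solver.solve-∀
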